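{- Let $\mathbf A$ be the Płonka sum of a semilattice directed system of metamorphisms $\{\xi_{pq}:\mathbf A_p\Rightarrow\mathbf A_q: p\preceq q\text{ in }\mathbf I\}$ between algebras of a finite type $\tau$ (with $\mathbf I$ having a least element if $\tau$ contains constants). Then $\mathbf A$ is locally finite if and only if every $\mathbf A_p$ ($p\in I$) is locally finite.
   Context: An algebra is locally finite if every finitely generated subalgebra is finite. A metamorphism $f:\mathbf A\Rightarrow\mathbf B$ between algebras of type $\tau$ assigns to each $n$-ary symbol $\sigma$ maps $f^{\sigma0},\dots,f^{\sigma n}:A\to B$ with $f^{\sigma0}(\sigma^{\mathbf A}(a_1,\dots,a_n))=\sigma^{\mathbf B}(f^{\sigma1}(a_1),\dots,f^{\sigma n}(a_n))$ (for constants $f^{\omega0}(\omega^{\mathbf A})=\omega^{\mathbf B}$); composition and identity are componentwise. A semilattice directed system of metamorphisms over a join-semilattice $\mathbf I=\langle I,\vee\rangle$ (order $\preceq$) is a family of pairwise disjoint algebras $\mathbf A_p$ of type $\tau$ with metamorphisms $\xi_{pq}:\mathbf A_p\Rightarrow\mathbf A_q$ for $p\preceq q$, $\xi_{pp}$ the identity, $\xi_{qr}\circ\xi_{pq}=\xi_{pr}$. Its Płonka sum is the algebra on $\biguplus_pA_p$ with $\sigma(a_1,\dots,a_n):=\sigma^{\mathbf A_q}(\xi^{\sigma1}_{p_1q}(a_1),\dots,\xi^{\sigma n}_{p_nq}(a_n))$ for $a_i\in A_{p_i}$, $q=p_1\vee\dots\vee p_n$, and $\omega:=\omega^{\mathbf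 A_\bot}$ for each constant $\omega$, where $\bot$ is the least element of $\mathbf I$. -}

module Defs where

open import Level using (Level; _⊔_) renaming (suc to lsuc)
open import Data.Fin using (Fin; zero; suc)
open import Data.List using (List)
open import Data.List.Membership.Propositional using (_∈_)
open import Data.Nat using (ℕ; zero; suc)
open import Data.Product using (Σ; ∃; _,_; proj₁; proj₂)
open import Data.Vec using (Vec; []; _∷_; foldr₁; lookup; map; tabulate)
open import Data.Vec.Properties using (tabulate∘lookup; lookup∘tabulate; tabulate-cong)
open import Data.Vec.Relation.Unary.All using (All)
open import Function using (id; _∘_)
open import Relation.Binary.Core using (Rel)
open import Relation.Binary.Definitions using (Minimum)
open import Relation.Binary.Lattice.Structures using (IsJoinSemilattice)
open import Relation.Binary.PropositionalEquality
open import Relation.Unary using (Pred; _≐_; U)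

private
  variable
    s a b c ℓ : Level

Finite : {A : Set a} → Pred A ℓ → Set (a ⊔ ℓ)
Finite {A = A} P = ∃ λ (xs : List A) → P ≐ (_∈ xs)

record Signature (s : Level) : Set (lsuc s) where
  field
    Symbol : Set s
    arity  : Symbol → ℕ

open Signature public

FiniteType : Signature s → Set s
FiniteType τ = Finite {A = Symbol τ} U

HasConstant : Signature s → Set s
HasConstant τ = ∃ λ (ω : Symbol τ) → arity τ ω ≡ 0

record Algebra (τ : Signature s) (a : Level) : Set (s ⊔ lsuc a) where
  field
    Carrier : Set a
    op      : (σ : Symbol τ) → Vec Carrier (arity τ σ) → Carrier

open Algebra public

-- The universe of the subalgebra generated by X.
data Sg {τ : Signature s} (A : Algebra τ a) (X : Pred (Carrier A) ℓ) :
        Pred (Carrier A) (s ⊔ a ⊔ ℓ) where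
  gen   : ∀ {x} → X x → Sg A X x
  apply : ∀ σ {xs} → All (Sg A X) xs → Sg A X (op A σ xs)

LocallyFinite : {τ : Signature s} → Algebra τ a → Set (s ⊔ a)
LocallyFinite A = (xs : List (Carrier A)) → Finite (Sg A (_∈ xs))

-- fun σ zero acts on the value of σ, and fun σ (suc i) on its i-th argument
-- (arguments counted from zero).  Nullary symbols need no separate clause.
record Metamorphism {τ : Signature s} (A : Algebra τ a) (B : Algebra τ b) :
                    Set (s ⊔ a ⊔ b) where
  field
    fun      : (σ : Symbol τ) → Fin (suc (arity τ σ)) → Carrier A → Carrier B
    commutes : ∀ σ (xs : Vec (Carrier A) (arity τ σ)) →
               fun σ zero (op A σ xs) ≡
               op B σ (tabulate λ i → fun σ (suc i) (lookup xs i))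

open Metamorphism public

infix 4 _≈ₘ_

_≈ₘ_ : {τ : Signature s} {A : Algebra τ a} {B : Algebra τ b} →
       Metamorphism A B → Metamorphism A B → Set (s ⊔ a ⊔ b)
_≈ₘ_ {τ = τ} {A = A} f g =
  (σ : Symbol τ) (i : Fin (suc (arity τ σ))) (x : Carrier A) →
  fun f σ i x ≡ fun g σ i x

idₘ : {τ : Signature s} (A : Algebra τ a) → Metamorphism A A
idₘ A = record
  { fun      = λ σ i → id
  ; commutes = λ σ xs → cong (op A σ) (sym (tabulate∘lookup xs))
  }

infixr 9 _∘ₘ_

_∘ₘ_ : {τ : Signature s} {A : Algebra τ a} {B : Algebra τ b} {C : Algebra τ c} →
       Metamorphism B C → Metamorphism A B → Metamorphism A C
_∘ₘ_ {C = C} g f = record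
  { fun      = λ σ i → fun g σ i ∘ fun f σ i
  ; commutes = λ σ xs → trans
      (cong (fun g σ zero) (commutes f σ xs))
      (trans (commutes g σ _)
             (cong (op C σ) (tabulate-cong λ i →
               cong (fun g σ (suc i)) (lookup∘tabulate _ i))))
  }

-- ξ takes a proof of p ≤ q, but ξ-id and ξ-∘ quantify over all such proofs,
-- so ξ depends only on p and q.
record DirectedSystem (τ : Signature s) (i r a : Level) :
                      Set (s ⊔ lsuc (i ⊔ r ⊔ a)) where
  infix  4 _≤_
  infixr 6 _∨_
  field
    I                 : Set i
    _≤_               : Rel I r
    _∨_               : I → I → I
    isJoinSemilattice : IsJoinSemilattice _≡_ _≤_ _∨_
    alg               : I → Algebra τ a
    ξ                 : ∀ {p q} → p ≤ q → Metamorphism (alg p) (alg q)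
    ξ-id              : ∀ {p} (p≤p : p ≤ p) → ξ p≤p ≈ₘ idₘ (alg p)
    ξ-∘               : ∀ {p q t} (p≤q : p ≤ q) (q≤t : q ≤ t) (p≤t : p ≤ t) →
                        ξ q≤t ∘ₘ ξ p≤q ≈ₘ ξ p≤t

  open IsJoinSemilattice isJoinSemilattice public
    using (x≤x∨y; y≤x∨y) renaming (refl to ≤-refl; trans to ≤-trans)

-- A least element of I is demanded only when τ has a nullary symbol; it is the
-- join of the empty tuple of indices.
module PłonkaSum {s i r a} {τ : Signature s} (S : DirectedSystem τ i r a)
  (least : HasConstant τ → ∃ (Minimum (DirectedSystem._≤_ S))) where

  open DirectedSystem S

  -- The disjoint union: carriers of distinct indices are made disjoint by tags.
  Sum : Set (i ⊔ a)
  Sum = Σ I λ p → Carrier (alg p)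

  join : ∀ {n} → (n ≡ 0 → ∃ (Minimum _≤_)) → Vec I n → I
  join bot []       = proj₁ (bot refl)
  join bot (p ∷ ps) = foldr₁ _∨_ (p ∷ ps)

  ≤-foldr₁ : ∀ {n} (x : Sum) (xs : Vec Sum n) j →
             proj₁ (lookup (x ∷ xs) j) ≤ foldr₁ _∨_ (map proj₁ (x ∷ xs))
  ≤-foldr₁ x []       zero    = ≤-refl
  ≤-foldr₁ x (y ∷ ys) zero    = x≤x∨y _ _
  ≤-foldr₁ x (y ∷ ys) (suc j) = ≤-trans (≤-foldr₁ y ys j) (y≤x∨y _ _)

  ≤-join : ∀ {n} (bot : n ≡ 0 → ∃ (Minimum _≤_)) (xs : Vec Sum n) j →
           proj₁ (lookup xs j) ≤ join bot (map proj₁ xs)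
  ≤-join bot (x ∷ xs) j = ≤-foldr₁ x xs j

  sum : Algebra τ (i ⊔ a)
  sum = record
    { Carrier = Sum
    ; op      = λ σ xs →
        let bot = λ σ-nullary → least (σ , σ-nullary)
            q   = join bot (map proj₁ xs)
        in q , op (alg q) σ (tabulate λ j →
                 fun (ξ (≤-join bot xs j)) σ (suc j) (proj₂ (lookup xs j)))
    }

{-# OPTIONS --safe #-}

-- From left to right: the fibre A_p is closed under the non-nullary operations
-- of the sum, which restrict to those of A_p, so the subalgebra of A_p generated
-- by X lies in the fibre at p of the one generated in the sum by X and the
-- finitely many constants of A_p.
-- From right to left: the indices met by the subalgebra generated by a finite X
-- lie in a finite join-closed set J.  By well-founded induction on q in J, the
-- fibre at q is finite: it lies in the subalgebra of A_q generated by the part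
-- of X over q and the images, under the finitely many maps of the system, of the
-- fibres strictly below q; an argument already over q is not moved, as ξ_qq is
-- the identity.
module Submission where

open import Defs
open import Level using (Level; _⊔_; Lift; lift; lower)
open import Data.Empty using (⊥; ⊥-elim)
open import Data.Fin using (Fin; suc)
open import Data.Fin.Induction using (po-wellFounded)
open import Data.List using (List; []; _∷_; _++_; concatMap; filter; allFin)
import Data.List as List
open import Data.List.Membership.Propositional using (_∈_; lose)
open import Data.List.Membership.Propositional.Properties
  using (∈-++⁺ˡ; ∈-++⁺ʳ; ∈-concatMap⁺; ∈-filter⁺; ∈-filter⁻; ∈-allFin)
open import Data.List.Relation.Unary.Any using (here; there; index)
open import Data.List.Relation.Unary.Any.Properties using (lookup-index)
open import Data.Nat using (zero; suc; _≟_)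
open import Data.Nat.Properties using (≡-irrelevant)
open import Data.Product using (∃; _×_; _,_; proj₁; proj₂)
open import Data.Sum using (_⊎_; inj₁; inj₂; [_,_])
open import Data.Unit using (tt)
open import Data.Vec using (Vec; []; _∷_; lookup; map; tabulate)
open import Data.Vec.Properties using (tabulate∘lookup; tabulate-cong; lookup-map)
open import Data.Vec.Relation.Unary.All using (All; []; _∷_)
import Data.Vec.Relation.Unary.All as All
open import Data.Vec.Relation.Unary.All.Properties using (map⁺; tabulate⁺; lookup⁺)
open import Function using (_⇔_; mk⇔; id; _∘_; _on_; Injective)
open import Axiom.ExcludedMiddle using (ExcludedMiddle)
open import Induction.WellFounded using (Acc; acc; WellFounded)
import Relation.Binary.Construct.NonStrictToStrict as ToStrict
import Relation.Binary.Construct.On as On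
open import Relation.Binary.Definitions using (Minimum)
open import Relation.Binary.Lattice.Bundles using (JoinSemilattice)
import Relation.Binary.Lattice.Properties.JoinSemilattice as JoinSemilatticeProperties
open import Relation.Binary.Lattice.Structures using (IsJoinSemilattice)
open import Relation.Binary.PropositionalEquality
  using (_≡_; _≢_; refl; sym; trans; cong; subst)
open import Relation.Nullary using (Dec; yes; no)
open import Relation.Nullary.Decidable using (map′)
open import Relation.Unary using (Pred; _⊆_; _∪_; U)

private
  variable
    s a b ℓ ℓ₁ ℓ₂ : Level

-- Excluded middle and finiteness up to inclusion.

lower-em : ∀ ℓ' → ExcludedMiddle (ℓ ⊔ ℓ') → ExcludedMiddle ℓ
lower-em ℓ' em {P} = map′ lower lift (em {Lift ℓ' P})

-- Only an upper estimate is asked for, so the notion passes to subsets; excluded middle recovers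
-- `Finite` by filtering the list.
Bounded : {A : Set a} → Pred A ℓ → Set (a ⊔ ℓ)
Bounded {A = A} P = ∃ λ (xs : List A) → P ⊆ (_∈ xs)

module _ {A : Set a} where

  finite⇒bounded : {P : Pred A ℓ} → Finite P → Bounded P
  finite⇒bounded (xs , P⊆ , _) = xs , P⊆

  bounded⇒finite : {P : Pred A ℓ} → ExcludedMiddle ℓ → Bounded P → Finite P
  bounded⇒finite {P = P} em (xs , P⊆) =
    filter P? xs , (λ Px → ∈-filter⁺ P? (P⊆ Px) Px)
                 , (λ x∈ → proj₂ (∈-filter⁻ P? {xs = xs} x∈))
    where
    P? : ∀ x → Dec (P x)
    P? x = em

  bounded-⊆ : {P : Pred A ℓ₁} {Q : Pred A ℓ₂} → P ⊆ Q → Bounded Q → Bounded P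
  bounded-⊆ P⊆Q (xs , Q⊆) = xs , λ Px → Q⊆ (P⊆Q Px)

  bounded-∈ : (xs : List A) → Bounded (_∈ xs)
  bounded-∈ xs = xs , id

  bounded-empty : {P : Pred A ℓ} → (∀ {x} → P x → ⊥) → Bounded P
  bounded-empty ¬P = [] , λ Px → ⊥-elim (¬P Px)

  bounded-∪ : {P : Pred A ℓ₁} {Q : Pred A ℓ₂} →
              Bounded P → Bounded Q → Bounded (P ∪ Q)
  bounded-∪ (xs , P⊆) (ys , Q⊆) =
    xs ++ ys , [ (λ Px → ∈-++⁺ˡ (P⊆ Px)) , (λ Qx → ∈-++⁺ʳ xs (Q⊆ Qx)) ]

module _ {A : Set a} {B : Set b} where

  bounded-⋃ : {P : Pred A ℓ₁} {F : A → Pred B ℓ₂} → Bounded P →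
              (∀ x → Bounded (F x)) → Bounded (λ y → ∃ λ x → P x × F x y)
  bounded-⋃ (xs , P⊆) F-bounded =
    concatMap (proj₁ ∘ F-bounded) xs ,
    λ (x , Px , Fxy) →
      ∈-concatMap⁺ (proj₁ ∘ F-bounded) (lose (P⊆ Px) (proj₂ (F-bounded x) Fxy))

  bounded-image : {P : Pred A ℓ} (f : A → B) → Bounded P →
                  Bounded (λ y → ∃ λ x → P x × y ≡ f x)
  bounded-image f P-bounded =
    bounded-⋃ P-bounded λ x → f x ∷ [] , here

module _ {A : Set a} {B : Set b} where

  -- Over each point the fibre of `f` has at most one element by injectivity, and excluded middle
  -- decides whether it has one.
  bounded-preimage : ExcludedMiddle (a ⊔ b) → {P : Pred B ℓ} (f : A → B) →
                     Injective _≡_ _≡_ f → Bounded P → Bounded (P ∘ f)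
  bounded-preimage em f f-injective P-bounded =
    bounded-⊆ (λ {x} Pfx → f x , Pfx , refl) (bounded-⋃ P-bounded fibre)
    where
    fibre : ∀ y → Bounded (λ x → f x ≡ y)
    fibre y with em {∃ λ x → f x ≡ y}
    ... | yes (x , fx≡y) =
      x ∷ [] , λ fx'≡y → here (f-injective (trans fx'≡y (sym fx≡y)))
    ... | no ∄x = bounded-empty λ {x} fx≡y → ∄x (x , fx≡y)

bounded-Fin : ∀ {n} → Bounded {A = Fin n} U
bounded-Fin {n} = allFin n , λ {i} _ → ∈-allFin i

bounded-constants : {τ : Signature s} → ExcludedMiddle s → FiniteType τ →
                    Bounded {A = HasConstant τ} U
bounded-constants em τ-finite =
  bounded-preimage em {P = U} proj₁ proj₁-injective (finite⇒bounded τ-finite)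
  where
  proj₁-injective : Injective _≡_ _≡_ proj₁
  -- A constant carries a proof that its arity is zero; such proofs are unique because `ℕ` is a set.
  proj₁-injective {σ , e} {.σ , e'} refl = cong (σ ,_) (≡-irrelevant e e')

-- Induction over generated subalgebras.

module _ {τ : Signature s} {A : Algebra τ a} {X : Pred (Carrier A) ℓ} where

  module _ (P : Pred (Carrier A) ℓ₁) (P-gen : X ⊆ P)
    (P-apply : ∀ σ {xs} → All (Sg A X) xs → All P xs → P (op A σ xs)) where

    -- The companion on vectors keeps the recursion visibly structural. `P-apply` also receives the
    -- membership of the arguments, which `Sg-fibre` uses for arguments strictly below its index.
    Sg-elim : Sg A X ⊆ P
    Sg-elim-All : ∀ {n} {xs : Vec (Carrier A) n} → All (Sg A X) xs → All P xs

    Sg-elim (gen Xx)        = P-gen Xx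
    Sg-elim (apply σ xs∈Sg) = P-apply σ xs∈Sg (Sg-elim-All xs∈Sg)

    Sg-elim-All []             = []
    Sg-elim-All (x∈Sg ∷ xs∈Sg) = Sg-elim x∈Sg ∷ Sg-elim-All xs∈Sg

  Sg-bounded : LocallyFinite A → Bounded X → Bounded (Sg A X)
  Sg-bounded A-finite (xs , X⊆) =
    bounded-⊆ (Sg-elim (Sg A (_∈ xs)) (λ Xx → gen (X⊆ Xx)) (λ σ _ → apply σ))
              (finite⇒bounded (A-finite xs))

-- Finite join-closed sets in a join-semilattice.

module _ {i r} {I : Set i} {_≤_ : I → I → Set r} {_∨_ : I → I → I}
  (isJoinSemilattice : IsJoinSemilattice _≡_ _≤_ _∨_) where

  JoinClosed : Pred I ℓ → Set (i ⊔ ℓ)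
  JoinClosed P = ∀ {p q} → P p → P q → P (p ∨ q)

  joinSemilattice : JoinSemilattice i i r
  joinSemilattice = record { isJoinSemilattice = isJoinSemilattice }

  open JoinSemilatticeProperties joinSemilattice
    using (∨-comm; ∨-assoc; ∨-idempotent)

  -- The joins of nonempty subfamilies of a list: `p` alone, without `p`, or `p` with others. The
  -- empty join is left out, as a least element need not exist.
  joins : List I → Pred I i
  joins []       q = q ∈ []
  joins (p ∷ ps) q = q ≡ p ⊎ joins ps q ⊎ (∃ λ u → joins ps u × q ≡ p ∨ u)

  joins-bounded : ∀ ps → Bounded (joins ps)
  joins-bounded []       = bounded-∈ []
  joins-bounded (p ∷ ps) =
    bounded-∪ (p ∷ [] , here)
      (bounded-∪ (joins-bounded ps) (bounded-image (p ∨_) (joins-bounded ps)))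

  ∈⇒joins : ∀ {ps q} → q ∈ ps → joins ps q
  ∈⇒joins (here q≡p)  = inj₁ q≡p
  ∈⇒joins (there q∈ps) = inj₂ (inj₁ (∈⇒joins q∈ps))

  -- Associativity and commutativity bring `p` to the front, idempotency absorbs a second `p`, and
  -- what remains is a join over the tail.
  joins-closed : ∀ ps → JoinClosed (joins ps)
  joins-closed []       ()
  joins-closed (p ∷ ps) = closed
    where
    head-∨ : ∀ {y} → joins (p ∷ ps) y → joins (p ∷ ps) (p ∨ y)
    head-∨ (inj₁ refl)                     = inj₁ (∨-idempotent p)
    head-∨ (inj₂ (inj₁ y∈))               = inj₂ (inj₂ (_ , y∈ , refl))
    head-∨ (inj₂ (inj₂ (u , u∈ , refl))) = inj₂ (inj₂ (u , u∈ ,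
      trans (sym (∨-assoc p p u)) (cong (_∨ u) (∨-idempotent p))))

    tail-∨ : ∀ {u y} → joins ps u → joins (p ∷ ps) y → joins (p ∷ ps) (u ∨ y)
    tail-∨ {u} u∈ (inj₁ refl)       = inj₂ (inj₂ (u , u∈ , ∨-comm u p))
    tail-∨ {u} u∈ (inj₂ (inj₁ y∈)) = inj₂ (inj₁ (joins-closed ps u∈ y∈))
    tail-∨ {u} u∈ (inj₂ (inj₂ (v , v∈ , refl))) =
      inj₂ (inj₂ (u ∨ v , joins-closed ps u∈ v∈ ,
        trans (sym (∨-assoc u p v))
              (trans (cong (_∨ v) (∨-comm u p)) (∨-assoc p u v))))

    closed : JoinClosed (joins (p ∷ ps))
    closed (inj₁ refl)                     y∈ = head-∨ y∈
    closed (inj₂ (inj₁ x∈))               y∈ = tail-∨ x∈ y∈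
    closed (inj₂ (inj₂ (u , u∈ , refl))) y∈ =
      subst (joins (p ∷ ps)) (sym (∨-assoc p u _)) (head-∨ (tail-∨ u∈ y∈))

-- Transition maps and operations of the Płonka sum.

module _ {s i r a} {τ : Signature s} (S : DirectedSystem τ i r a)
  (least : HasConstant τ → ∃ (Minimum (DirectedSystem._≤_ S))) where

  open DirectedSystem S
  open PłonkaSum S least

  -- By `ξ-∘`, the map `ξ h` factors as `ξ h'` after `ξ ≤-refl`, which is the identity.
  ξ-irrelevant : ∀ {p q} (h h' : p ≤ q) → ξ h ≈ₘ ξ h'
  ξ-irrelevant h h' σ j x =
    trans (sym (ξ-∘ ≤-refl h' h σ j x)) (cong (fun (ξ h') σ j) (ξ-id ≤-refl σ j x))

  ξ-fibre : ∀ {y : Sum} {q} {x : Carrier (alg q)} (h : proj₁ y ≤ q) →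
            y ≡ (q , x) → ∀ σ j → fun (ξ h) σ j (proj₂ y) ≡ x
  ξ-fibre h refl σ j = ξ-id h σ j _

  join-closed : ∀ {Q : Pred I ℓ} → JoinClosed isJoinSemilattice Q →
                ∀ {n} (bot : n ≡ 0 → ∃ (Minimum _≤_)) → (∀ e → Q (proj₁ (bot e))) →
                (ps : Vec I n) → All Q ps → Q (join bot ps)
  join-closed Q-∨ bot Q-bot []           []                = Q-bot refl
  join-closed Q-∨ bot Q-bot (p ∷ [])     (Qp ∷ [])         = Qp
  join-closed Q-∨ bot Q-bot (p ∷ q ∷ ps) (Qp ∷ Qq ∷ Qps) =
    -- The tail is nonempty, so its join never consults a least element and both arguments about it
    -- are absurd.
    Q-∨ Qp (join-closed Q-∨ {suc _} (λ ()) (λ ()) (q ∷ ps) (Qq ∷ Qps))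

  join-constant : ∀ {n} (bot : suc n ≡ 0 → ∃ (Minimum _≤_)) {p} (ps : Vec I (suc n)) →
                  All (_≡ p) ps → join bot ps ≡ p
  join-constant bot {p} ps ps≡p =
    -- The singleton of `p` is join-closed by idempotency.
    join-closed {Q = _≡ p} (λ { refl refl → ∨-idempotent p }) bot (λ ()) ps ps≡p
    where
    open JoinSemilatticeProperties (joinSemilattice isJoinSemilattice)
      using (∨-idempotent)

  inject : ∀ p → Carrier (alg p) → Sum
  inject p x = p , x

  inject-injective : ∀ p → Injective _≡_ _≡_ (inject p)
  inject-injective p refl = refl

  -- The join of copies of `p` is `p`, so the maps applied to the arguments are identities. Nullary
  -- symbols are excluded, their value lying over the least index.
  op-fibre : ∀ σ → arity τ σ ≢ 0 → ∀ {p} (xs : Vec (Carrier (alg p)) (arity τ σ)) →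
             op sum σ (map (inject p) xs) ≡ (p , op (alg p) σ xs)
  op-fibre σ σ-nonnullary {p} xs =
    at-index (λ j → lookup-map j (inject p) xs)
             (≤-join _ ys)
             (constant (λ e → least (σ , e)) σ-nonnullary xs)
    where
    ys = map (inject p) xs

    constant : ∀ {n} (bot : n ≡ 0 → ∃ (Minimum _≤_)) → n ≢ 0 →
               (zs : Vec (Carrier (alg p)) n) → join bot (map proj₁ (map (inject p) zs)) ≡ p
    constant {zero}  bot n≢0 zs = ⊥-elim (n≢0 refl)
    constant {suc n} bot n≢0 zs =
      join-constant bot _
        (map⁺ (map⁺ (All.universal (λ _ → refl) zs)))

    -- The join equals `p` only propositionally; generalising it to a variable `q` lets the equation
    -- be matched with `refl`.
    at-index : ∀ {q} → (∀ j → lookup ys j ≡ (p , lookup xs j)) →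
               (h : ∀ j → proj₁ (lookup ys j) ≤ q) → q ≡ p →
               _≡_ {A = Sum}
                 (q , op (alg q) σ (tabulate λ j →
                        fun (ξ (h j)) σ (suc j) (proj₂ (lookup ys j))))
                 (p , op (alg p) σ xs)
    at-index ys≡xs h refl = cong (λ zs → p , op (alg p) σ zs)
      (trans (tabulate-cong λ j → ξ-fibre (h j) (ys≡xs j) σ (suc j))
             (tabulate∘lookup xs))

  -- From the sum to its summands.

  constant-in : ∀ p → HasConstant τ → Carrier (alg p)
  constant-in p (σ , e) = op (alg p) σ (subst (Vec _) (sym e) [])

  nullary-value : ∀ p σ (e : arity τ σ ≡ 0) xs →
                  op (alg p) σ xs ≡ constant-in p (σ , e)
  nullary-value p σ e xs = cong (op (alg p) σ) (unique e xs)
    where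
    unique : ∀ {n} (e : n ≡ 0) (xs : Vec (Carrier (alg p)) n) →
             xs ≡ subst (Vec _) (sym e) []
    unique refl [] = refl

  sum⇒fibre : ExcludedMiddle (s ⊔ i ⊔ a) → FiniteType τ →
              LocallyFinite sum → ∀ p → LocallyFinite (alg p)
  sum⇒fibre em τ-finite sum-finite p xs =
    bounded⇒finite (lower-em i em)
      (bounded-⊆
        (Sg-elim (λ x → Sg sum X (p , x))
          (λ {x} x∈xs → gen (x , inj₁ x∈xs , refl)) closed)
        (bounded-preimage (lower-em s em) (inject p) (inject-injective p)
          (Sg-bounded sum-finite X-bounded)))
    where
    -- The constants of `alg p` become generators because the sum evaluates nullary symbols at the
    -- least index, possibly not `p`.
    Y : Pred (Carrier (alg p)) (s ⊔ a)
    Y x = x ∈ xs ⊎ (∃ λ c → U c × x ≡ constant-in p c)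

    X : Pred Sum (s ⊔ i ⊔ a)
    X z = ∃ λ x → Y x × z ≡ (p , x)

    X-bounded : Bounded X
    X-bounded = bounded-image (inject p)
      (bounded-∪ (bounded-∈ xs)
        (bounded-image (constant-in p)
          (bounded-constants (lower-em (i ⊔ a) em) τ-finite)))

    closed : ∀ σ {zs} → All (Sg (alg p) (_∈ xs)) zs →
             All (λ x → Sg sum X (p , x)) zs → Sg sum X (p , op (alg p) σ zs)
    closed σ {zs} _ zs∈Sg with arity τ σ ≟ 0
    ... | yes e = gen (_ , inj₂ ((σ , e) , tt , nullary-value p σ e zs) , refl)
    ... | no e  = subst (Sg sum X) (op-fibre σ e zs) (apply σ (map⁺ zs∈Sg))

  -- Indices and fibres of a generated subalgebra of the sum.

  module _ {X : Pred Sum ℓ} where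

    module _ {Q : Pred I ℓ₁} (Q-∨ : JoinClosed isJoinSemilattice Q)
      (Q-bot : ∀ c → Q (proj₁ (least c))) (Q-gen : ∀ {z} → X z → Q (proj₁ z)) where

      Sg-index : ∀ {z} → Sg sum X z → Q (proj₁ z)
      Sg-index = Sg-elim (Q ∘ proj₁) Q-gen λ σ {zs} _ Qzs →
        join-closed {Q = Q} Q-∨ _ (λ e → Q-bot (σ , e)) _ (map⁺ Qzs)

    module _ {q} {G : Pred (Carrier (alg q)) ℓ₁} (em : ExcludedMiddle i)
      (G-gen : ∀ {x} → X (q , x) → G x)
      (G-below : ∀ {z} (h : proj₁ z ≤ q) → proj₁ z ≢ q → Sg sum X z →
                 ∀ σ j → G (fun (ξ h) σ j (proj₂ z))) where

      Sg-fibre : ∀ {x} → Sg sum X (q , x) → Sg (alg q) G x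
      Sg-fibre = λ x∈Sg →
        Sg-elim Over (λ { Xz refl → gen (G-gen Xz) }) closed x∈Sg refl
        where
        -- The induction runs over the whole sum; the equation makes the claim vacuous away from
        -- `q`, where `G-below` takes over.
        Over : Pred Sum _
        Over z = ∀ {x} → z ≡ (q , x) → Sg (alg q) G x

        moved : ∀ {z} (h : proj₁ z ≤ q) → Sg sum X z → Over z →
                ∀ σ j → Sg (alg q) G (fun (ξ h) σ j (proj₂ z))
        moved {p , x} h z∈Sg z-over σ j with em {p ≡ q}
        ... | yes refl = subst (Sg (alg q) G) (sym (ξ-id h σ j x)) (z-over refl)
        ... | no p≢q   = gen (G-below h p≢q z∈Sg σ j)

        closed : ∀ σ {zs} → All (Sg sum X) zs → All Over zs → Over (op sum σ zs)
        closed σ {zs} zs∈Sg zs-over refl = apply σ (tabulate⁺ λ j →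
          moved (≤-join _ zs j) (lookup⁺ zs∈Sg j) (lookup⁺ zs-over j) σ (suc j))

  -- From the summands to the sum.

  fibre⇒sum : ExcludedMiddle (s ⊔ i ⊔ r ⊔ a) → FiniteType τ →
              (∀ p → LocallyFinite (alg p)) → LocallyFinite sum
  fibre⇒sum em τ-finite fibre-finite xs =
    bounded⇒finite (lower-em r em)
      (bounded-⊆ located
        (bounded-⋃ {P = U} bounded-Fin λ k →
          bounded-image (inject (at k)) (fibre-bounded k (⊏-wellFounded k))))
    where
    X : Pred Sum (i ⊔ a)
    X = _∈ xs

    -- Constants contribute the least index, an empty join that `joins` does not supply by itself.
    Index : Pred I (s ⊔ i ⊔ a)
    Index q = (∃ λ z → X z × q ≡ proj₁ z) ⊎ (∃ λ c → U c × q ≡ proj₁ (least c))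

    index-bounded : Bounded Index
    index-bounded =
      bounded-∪ (bounded-image proj₁ (bounded-∈ xs))
                (bounded-image (proj₁ ∘ least)
                  (bounded-constants (lower-em (i ⊔ r ⊔ a) em) τ-finite))

    Joins : Pred I i
    Joins = joins isJoinSemilattice (proj₁ index-bounded)

    Index⊆Joins : Index ⊆ Joins
    Index⊆Joins = ∈⇒joins isJoinSemilattice ∘ proj₂ index-bounded

    J-bounds : Bounded Joins
    J-bounds = joins-bounded isJoinSemilattice (proj₁ index-bounded)

    J : List I
    J = proj₁ J-bounds

    at : Fin (List.length J) → I
    at = List.lookup J

    Sg-index-∈J : ∀ {z} → Sg sum X z → proj₁ z ∈ J
    Sg-index-∈J z∈Sg = proj₂ J-bounds
      (Sg-index (joins-closed isJoinSemilattice (proj₁ index-bounded))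
        (λ c → Index⊆Joins (inj₂ (c , tt , refl)))
        (λ Xz → Index⊆Joins (inj₁ (_ , Xz , refl))) z∈Sg)

    at-index : ∀ {z} → Sg sum X z → ∃ λ k → proj₁ z ≡ at k
    at-index z∈Sg = index (Sg-index-∈J z∈Sg) , lookup-index (Sg-index-∈J z∈Sg)

    -- `J` may list an index twice, so positions are compared through `at`, for equality as well;
    -- this is still a partial order on a finite set.
    open ToStrict (_≡_ on at) (_≤_ on at) renaming (_<_ to _⊏_)

    ⊏-wellFounded : WellFounded _⊏_
    ⊏-wellFounded = po-wellFounded
      (On.isPartialOrder at (IsJoinSemilattice.isPartialOrder isJoinSemilattice))

    Fibre : ∀ k → Pred (Carrier (alg (at k))) (s ⊔ i ⊔ a)
    Fibre k x = Sg sum X (at k , x)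

    located : ∀ {z} → Sg sum X z →
              ∃ λ k → U k × ∃ λ x → Fibre k x × z ≡ (at k , x)
    located {p , x} z∈Sg with at-index z∈Sg
    ... | k , refl = k , tt , x , z∈Sg , refl

    Image : ∀ l k → Symbol τ → Pred (Carrier (alg (at l))) (s ⊔ i ⊔ r ⊔ a)
    Image l k σ y = ∃ λ j → U j × ∃ λ (k⊏l : k ⊏ l) → ∃ λ x →
                    Fibre k x × y ≡ fun (ξ (proj₁ k⊏l)) σ j x

    Generators : ∀ l → Pred (Carrier (alg (at l))) (s ⊔ i ⊔ r ⊔ a)
    Generators l y = X (at l , y) ⊎
      (∃ λ k → U k × ∃ λ σ → U σ × Image l k σ y)

    image-bounded : ∀ l k → (k ⊏ l → Bounded (Fibre k)) → ∀ σ → Bounded (Image l k σ)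
    image-bounded l k below σ = bounded-⋃ bounded-Fin λ j → through j
      where
      through : ∀ j → Bounded (λ y → ∃ λ (k⊏l : k ⊏ l) → ∃ λ x →
                                 Fibre k x × y ≡ fun (ξ (proj₁ k⊏l)) σ j x)
      -- All proofs of `k ⊏ l` induce the same map, so the image under one chosen proof covers the
      -- union over all of them.
      through j with lower-em (s ⊔ a) em {k ⊏ l}
      ... | no k⋢l  = bounded-empty λ (k⊏l , _) → k⋢l k⊏l
      ... | yes k⊏l = bounded-⊆
        (λ (k⊏l' , x , x∈Sg , y≡) →
           x , x∈Sg , trans y≡ (ξ-irrelevant (proj₁ k⊏l') (proj₁ k⊏l) σ j x))
        (bounded-image (fun (ξ (proj₁ k⊏l)) σ j) (below k⊏l))

    below-generates : ∀ {l z} (h : proj₁ z ≤ at l) → proj₁ z ≢ at l → Sg sum X z →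
                      ∀ σ j → Generators l (fun (ξ h) σ j (proj₂ z))
    -- Membership in the subalgebra puts the index of `z` at some position `k` of `J`; with `h` and
    -- `p≢` this gives `k ⊏ l`.
    below-generates {z = p , x} h p≢ z∈Sg σ j with at-index z∈Sg
    ... | k , refl =
      inj₂ (k , tt , σ , tt , j , tt , (h , p≢) , x , z∈Sg , refl)

    fibre-bounded : ∀ l → Acc _⊏_ l → Bounded (Fibre l)
    fibre-bounded l (acc below) = bounded-⊆
      (Sg-fibre (lower-em (s ⊔ r ⊔ a) em) inj₁ below-generates)
      (Sg-bounded (fibre-finite (at l))
        (bounded-∪
          (bounded-preimage (lower-em (s ⊔ r) em) (inject (at l)) (inject-injective (at l))
            (bounded-∈ xs))
          (bounded-⋃ bounded-Fin λ k →
            -- Finiteness of `τ` leaves only finitely many maps from position `k` to position `l`.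
            bounded-⋃ (finite⇒bounded τ-finite)
              (image-bounded l k λ k⊏l → fibre-bounded k (below k⊏l)))))

theorem4p7 : {s i r a : Level} →
    ExcludedMiddle (s ⊔ i ⊔ r ⊔ a) →
    (τ : Signature s) → FiniteType τ →
    (S : DirectedSystem τ i r a) →
    (least : HasConstant τ → ∃ (Minimum (DirectedSystem._≤_ S))) →
    LocallyFinite (PłonkaSum.sum S least) ⇔
    ((p : DirectedSystem.I S) → LocallyFinite (DirectedSystem.alg S p))
theorem4p7 {r = r} em τ τ-finite S least =
  mk⇔ (sum⇒fibre S least (lower-em r em) τ-finite) (fibre⇒sum S least em τ-finite)
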